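{- Let $q$ be a prime power. For every integer $m\ge1$, the length $n=q^m-1$ is not exceptional for $q$; that is, $\operatorname{Aut}_q(q^m-1)=\operatorname{Aff}_q(q^m-1)$.
   Context: For a positive integer $n$ coprime to $q$, let $\mathbb{Z}_n=\mathbb{Z}/n\mathbb{Z}$ and let $\langle q\rangle$ be the subgroup of $\mathbb{Z}_n^\times$ generated by $q$. The cyclotomic association scheme $\operatorname{Cyc}(\langle q\rangle,\mathbb{Z}_n)$ is the pair $(\mathbb{Z}_n,\pi)$ with coloring $\pi(x,y):=(y-x)\langle q\rangle$ (the orbit of $y-x$ under multiplication by $\langle q\rangle$), and $\operatorname{Aut}_q(n):=\operatorname{Aut}(\operatorname{Cyc}(\langle q\rangle,\mathbb{Z}_n))$ is the group of all permutations $\sigma$ of $\mathbb{Z}_n$ with $\pi(\sigma x,\sigma y)=\pi(x,y)$ for all $x,y\in\mathbb{Z}_n$. The $q$-affine group is $\operatorname{Aff}_q(n):=\{x\mapsto kx+b:\ k\in\langle q\rangle,\ b\in\mathbb{Z}_n\}\le\operatorname{Sym}(\mathbb{Z}_n)$, a subgroup of $\operatorname{Aut}_q(n)$. The integer $n$ is called an exceptional length for $q$ if $\operatorname{Aut}_q(n)\neq\operatorname{Aff}_q(n)$. -}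

module Defs where

open import Data.Fin.Base using (Fin; toℕ)
open import Data.Fin.Permutation using (Permutation′; _⟨$⟩ʳ_)
open import Data.Nat.Base
open import Data.Nat.Coprimality using (Coprime)
open import Data.Nat.DivMod using (_mod_)
open import Data.Nat.Primality using (Prime; prime⇒nonTrivial)
open import Data.Nat.Properties
  using (^-monoʳ-<; m<n⇒0<n∸m)
open import Data.Product.Base using (∃-syntax; ∃₂; _×_; _,_)
open import Level using (0ℓ)
open import Relation.Binary.PropositionalEquality using (_≡_; refl)
open import Relation.Nullary.Negation using (¬_)
open import Relation.Unary using (Pred; _∈_; _≐_)

ℤ/_ : ℕ → Set
ℤ/ n = Fin n

infixl 6 _⊕_ _⊖_
infixl 7 _⊗_

_⊕_ _⊖_ _⊗_ : ∀ {n} .{{_ : NonZero n}} → ℤ/ n → ℤ/ n → ℤ/ n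
_⊕_ {n} x y = (toℕ x + toℕ y) mod n
_⊖_ {n} x y = (toℕ x + (n ∸ toℕ y)) mod n
_⊗_ {n} x y = (toℕ x * toℕ y) mod n

-- The subgroup of (ℤ/ n)ˣ generated by g; meaningful when g is a unit.
data ⟨_⟩ {n} .{{_ : NonZero n}} (g : ℤ/ n) : Pred (ℤ/ n) 0ℓ where
  gen : g ∈ ⟨ g ⟩
  one : (1 mod n) ∈ ⟨ g ⟩
  mul : ∀ {h k} → h ∈ ⟨ g ⟩ → k ∈ ⟨ g ⟩ → (h ⊗ k) ∈ ⟨ g ⟩
  inv : ∀ {h k} → h ∈ ⟨ g ⟩ → h ⊗ k ≡ 1 mod n → k ∈ ⟨ g ⟩

module _ (q n : ℕ) .{{_ : NonZero n}} where

  orbit : ℤ/ n → Pred (ℤ/ n) 0ℓ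
  orbit x z = ∃[ k ] k ∈ ⟨ q mod n ⟩ × z ≡ k ⊗ x

  -- Colours are orbits, i.e. subsets of ℤ/ n, so they are compared by _≐_.
  colour : ℤ/ n → ℤ/ n → Pred (ℤ/ n) 0ℓ
  colour x y = orbit (y ⊖ x)

  Aut : Pred (Permutation′ n) 0ℓ
  Aut σ = ∀ x y → colour (σ ⟨$⟩ʳ x) (σ ⟨$⟩ʳ y) ≐ colour x y

  Aff : Pred (Permutation′ n) 0ℓ
  Aff σ = ∃₂ λ k b → k ∈ ⟨ q mod n ⟩ × (∀ x → σ ⟨$⟩ʳ x ≡ k ⊗ x ⊕ b)

record Exceptional (q n : ℕ) : Set where
  field
    {{positive}} : NonZero n
    coprime      : Coprime n q
    Aut≢Aff      : ¬ (Aut q n ≐ Aff q n)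

PrimePower : Pred ℕ 0ℓ
PrimePower q = ∃₂ λ p k → Prime p × 1 ≤ k × q ≡ p ^ k

private
  1<^ : ∀ {a} → 1 < a → ∀ {k} → 1 ≤ k → 1 < a ^ k
  1<^ {a} 1<a 1≤k = ^-monoʳ-< a 1<a 1≤k

q^m∸1-nonZero : ∀ {q m} → PrimePower q → 1 ≤ m → NonZero (q ^ m ∸ 1)
q^m∸1-nonZero (p , k , p-prime , 1≤k , refl) 1≤m =
  >-nonZero (m<n⇒0<n∸m (1<^ (1<^ 1<p 1≤k) 1≤m))
  where 1<p = nonTrivial⇒n>1 p {{prime⇒nonTrivial p-prime}}

{-# OPTIONS --safe #-}
-- Let σ ∈ Aut.  The colours of (x , x + 1) and (x , x + 2) give
-- σ (x + 1) = σ x + q^a, σ (x + 2) = σ (x + 1) + q^c and σ (x + 2) = σ x + 2 q^b,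
-- hence q^a + q^c ≡ 2 q^b modulo n = q^m - 1.  Multiplying by q^-b and reducing
-- the exponents below m leaves q^a + q^c ≡ 2 with both sides in [2 , n + 1],
-- so q^a = q^c = 1: the increment q^a does not depend on x, and σ is affine.
module Submission where

open import Defs
open import Data.Fin.Base using (toℕ)
open import Data.Fin.Permutation using (_⟨$⟩ʳ_)
open import Data.Fin.Properties using (toℕ-injective; toℕ<n; toℕ-fromℕ<)
open import Data.Nat.Base
open import Data.Nat.DivMod
open import Data.Nat.Primality using (prime⇒nonTrivial)
open import Data.Nat.Properties
open import Data.Nat.Tactic.RingSolver using (solve-∀)
open import Data.Product.Base using (∃-syntax; _×_; _,_; proj₁; proj₂)
open import Relation.Binary.Bundles using (Setoid)
open import Relation.Binary.PropositionalEquality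
open import Relation.Nullary.Negation using (¬_)
open import Relation.Unary using (_≐_; _⊆_; _∈_)
import Relation.Binary.Reasoning.Setoid as SetoidReasoning

-- Residues modulo `n`, handled through natural number representatives.

module Congruence (n : ℕ) .{{_ : NonZero n}} where

  infix 4 _≋_

  -- A record rather than a bare equation of remainders, so that unification can read `a` and `b`
  -- off the type instead of having to invert `_%_`.
  record _≋_ (a b : ℕ) : Set where
    constructor mk≋
    field %-≡ : a % n ≡ b % n

  ≋-setoid : Setoid _ _
  ≋-setoid = record
    { Carrier = ℕ
    ; _≈_ = _≋_
    ; isEquivalence = record
      { refl  = mk≋ refl
      ; sym   = λ (mk≋ e) → mk≋ (sym e)
      ; trans = λ (mk≋ e) (mk≋ f) → mk≋ (trans e f)
      }
    }

  open Setoid ≋-setoid public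
    using () renaming (refl to ≋-refl; sym to ≋-sym; trans to ≋-trans; reflexive to ≋-reflexive)
  open SetoidReasoning ≋-setoid

  +-≋ : ∀ {a b c d} → a ≋ b → c ≋ d → a + c ≋ b + d
  +-≋ {a} {b} {c} {d} (mk≋ e) (mk≋ f) = mk≋
    (trans (%-distribˡ-+ a c n) (trans (cong₂ (λ u v → (u + v) % n) e f) (sym (%-distribˡ-+ b d n))))

  *-≋ : ∀ {a b c d} → a ≋ b → c ≋ d → a * c ≋ b * d
  *-≋ {a} {b} {c} {d} (mk≋ e) (mk≋ f) = mk≋
    (trans (%-distribˡ-* a c n) (trans (cong₂ (λ u v → (u * v) % n) e f) (sym (%-distribˡ-* b d n))))

  ^-≋ : ∀ {a b} i → a ≋ b → a ^ i ≋ b ^ i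
  ^-≋ zero    e = ≋-refl
  ^-≋ (suc i) e = *-≋ e (^-≋ i e)

  %-≋ : ∀ a → a % n ≋ a
  %-≋ a = mk≋ (m%n%n≡m%n a n)

  -- Adding `c * pred n` acts as subtracting `c`, because `c + c * pred n` is the multiple `c * n`
  -- of the modulus. This avoids truncated subtraction.
  ≋-cancelʳ-+ : ∀ {a b} c → a + c ≋ b + c → a ≋ b
  ≋-cancelʳ-+ {a} {b} c e = begin
    a                  ≈⟨ absorb a ⟨
    a + c + c * pred n ≈⟨ +-≋ e ≋-refl ⟩
    b + c + c * pred n ≈⟨ absorb b ⟩
    b                  ∎
    where
    absorb : ∀ x → x + c + c * pred n ≋ x
    absorb x = ≋-trans
      (≋-reflexive (trans (+-assoc x c _)
        (cong (x +_) (trans (sym (*-suc c (pred n))) (cong (c *_) (suc-pred n))))))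
      (mk≋ ([m+kn]%n≡m%n x c n))

  ≋-small⇒≡ : ∀ {a b} → a < n → b < n → a ≋ b → a ≡ b
  ≋-small⇒≡ a<n b<n (mk≋ e) = trans (sym (m<n⇒m%n≡m a<n)) (trans e (m<n⇒m%n≡m b<n))

  toℕ-≋-injective : ∀ {x y : ℤ/ n} → toℕ x ≋ toℕ y → x ≡ y
  toℕ-≋-injective {x} {y} e = toℕ-injective (≋-small⇒≡ (toℕ<n x) (toℕ<n y) e)

  toℕ-mod : ∀ a → toℕ (a mod n) ≋ a
  toℕ-mod a = ≋-trans (≋-reflexive (toℕ-fromℕ< (m%n<n a n))) (%-≋ a)

  mod-toℕ : ∀ (x : ℤ/ n) → toℕ x mod n ≡ x
  mod-toℕ x = toℕ-≋-injective (toℕ-mod (toℕ x))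

  toℕ-⊕ : ∀ (x y : ℤ/ n) → toℕ (x ⊕ y) ≋ toℕ x + toℕ y
  toℕ-⊕ x y = toℕ-mod (toℕ x + toℕ y)

  toℕ-⊗ : ∀ (x y : ℤ/ n) → toℕ (x ⊗ y) ≋ toℕ x * toℕ y
  toℕ-⊗ x y = toℕ-mod (toℕ x * toℕ y)

  -- The additive form keeps `∸` out of later arguments: a difference is determined by adding
  -- `toℕ y` and cancelling.
  toℕ-⊖ : ∀ (x y : ℤ/ n) → toℕ (x ⊖ y) + toℕ y ≋ toℕ x
  toℕ-⊖ x y = begin
    toℕ (x ⊖ y) + toℕ y           ≈⟨ +-≋ (toℕ-mod _) ≋-refl ⟩
    toℕ x + (n ∸ toℕ y) + toℕ y   ≡⟨ +-assoc (toℕ x) _ _ ⟩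
    toℕ x + (n ∸ toℕ y + toℕ y)   ≡⟨ cong (toℕ x +_) (m∸n+n≡m (<⇒≤ (toℕ<n y))) ⟩
    toℕ x + n                     ≈⟨ mk≋ ([m+n]%n≡m%n (toℕ x) n) ⟩
    toℕ x                         ∎

  ⊗-assoc : ∀ (x y z : ℤ/ n) → (x ⊗ y) ⊗ z ≡ x ⊗ (y ⊗ z)
  ⊗-assoc x y z = toℕ-≋-injective (begin
    toℕ ((x ⊗ y) ⊗ z)         ≈⟨ toℕ-⊗ (x ⊗ y) z ⟩
    toℕ (x ⊗ y) * toℕ z       ≈⟨ *-≋ (toℕ-⊗ x y) ≋-refl ⟩
    toℕ x * toℕ y * toℕ z     ≡⟨ *-assoc (toℕ x) _ _ ⟩
    toℕ x * (toℕ y * toℕ z)   ≈⟨ *-≋ (≋-refl {toℕ x}) (toℕ-⊗ y z) ⟨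
    toℕ x * toℕ (y ⊗ z)       ≈⟨ toℕ-⊗ x (y ⊗ z) ⟨
    toℕ (x ⊗ (y ⊗ z))         ∎)

  ⊗-comm : ∀ (x y : ℤ/ n) → x ⊗ y ≡ y ⊗ x
  ⊗-comm x y = cong (_mod n) (*-comm (toℕ x) (toℕ y))

  ⊗-identityˡ : ∀ (x : ℤ/ n) → (1 mod n) ⊗ x ≡ x
  ⊗-identityˡ x = toℕ-≋-injective (begin
    toℕ ((1 mod n) ⊗ x)       ≈⟨ toℕ-⊗ (1 mod n) x ⟩
    toℕ (1 mod n) * toℕ x     ≈⟨ *-≋ (toℕ-mod 1) ≋-refl ⟩
    1 * toℕ x                 ≡⟨ *-identityˡ (toℕ x) ⟩
    toℕ x                     ∎)

  -- The translation `b` drops out of differences, so an affine map acts on them, and hence on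
  -- colours, through `k` alone.
  affine-⊖ : ∀ (k b x y : ℤ/ n) → (k ⊗ y ⊕ b) ⊖ (k ⊗ x ⊕ b) ≡ k ⊗ (y ⊖ x)
  affine-⊖ k b x y = toℕ-≋-injective (≋-cancelʳ-+ (toℕ (k ⊗ x ⊕ b)) (begin
    toℕ ((k ⊗ y ⊕ b) ⊖ (k ⊗ x ⊕ b)) + toℕ (k ⊗ x ⊕ b) ≈⟨ toℕ-⊖ (k ⊗ y ⊕ b) (k ⊗ x ⊕ b) ⟩
    toℕ (k ⊗ y ⊕ b)                                   ≈⟨ toℕ-affine y ⟩
    K * toℕ y + B                                     ≈⟨ +-≋ (*-≋ (≋-refl {K}) (toℕ-⊖ y x)) ≋-refl ⟨
    K * (toℕ (y ⊖ x) + toℕ x) + B                     ≡⟨ expand K (toℕ (y ⊖ x)) (toℕ x) B ⟩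
    K * toℕ (y ⊖ x) + (K * toℕ x + B)                 ≈⟨ +-≋ (toℕ-⊗ k (y ⊖ x)) (toℕ-affine x) ⟨
    toℕ (k ⊗ (y ⊖ x)) + toℕ (k ⊗ x ⊕ b)               ∎))
    where
    K = toℕ k
    B = toℕ b
    toℕ-affine : ∀ z → toℕ (k ⊗ z ⊕ b) ≋ K * toℕ z + B
    toℕ-affine z = ≋-trans (toℕ-⊕ (k ⊗ z) b) (+-≋ (toℕ-⊗ k z) ≋-refl)
    expand : ∀ a u v w → a * (u + v) + w ≡ a * u + (a * v + w)
    expand = solve-∀

-- The paper's m is suc m here.
module _ (q m n : ℕ) .{{_ : NonZero n}} (1<q : 1 < q) (suc-n : suc n ≡ q ^ suc m) where

  private instance
    q≢0 : NonZero q
    q≢0 = >-nonZero (<-trans z<s 1<q)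

  open Congruence n
  open SetoidReasoning ≋-setoid

  -- Powers of `q` modulo `n` and the subgroup they form.

  q^[1+m]≋1 : q ^ suc m ≋ 1
  q^[1+m]≋1 = ≋-trans (≋-reflexive (sym suc-n)) (mk≋ ([m+n]%n≡m%n 1 n))

  q^[k*[1+m]]≋1 : ∀ k → q ^ (k * suc m) ≋ 1
  q^[k*[1+m]]≋1 k = begin
    q ^ (k * suc m)   ≡⟨ cong (q ^_) (*-comm k (suc m)) ⟩
    q ^ (suc m * k)   ≡⟨ ^-*-assoc q (suc m) k ⟨
    (q ^ suc m) ^ k   ≈⟨ ^-≋ k q^[1+m]≋1 ⟩
    1 ^ k             ≡⟨ ^-zeroˡ k ⟩
    1                 ∎

  -- The exponents add up to `i * suc m`, a multiple of the period `suc m`. Inverses are thus again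
  -- powers with natural exponents.
  q^-inverse : ∀ i → q ^ i * q ^ (i * m) ≋ 1
  q^-inverse i = begin
    q ^ i * q ^ (i * m)   ≡⟨ ^-distribˡ-+-* q i (i * m) ⟨
    q ^ (i + i * m)       ≡⟨ cong (q ^_) (*-suc i m) ⟨
    q ^ (i * suc m)       ≈⟨ q^[k*[1+m]]≋1 i ⟩
    1                     ∎

  q^-reduce : ∀ i → q ^ i ≋ q ^ (i % suc m)
  q^-reduce i = begin
    q ^ i                        ≡⟨ cong (q ^_) (m≡m%n+[m/n]*n i (suc m)) ⟩
    q ^ (r + k * suc m)          ≡⟨ ^-distribˡ-+-* q r (k * suc m) ⟩
    q ^ r * q ^ (k * suc m)      ≈⟨ *-≋ (≋-refl {q ^ r}) (q^[k*[1+m]]≋1 k) ⟩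
    q ^ r * 1                    ≡⟨ *-identityʳ (q ^ r) ⟩
    q ^ r                        ∎
    where
    r = i % suc m
    k = i / suc m

  -- Induction on the derivation of membership. Closure under inverses is the one case needing the
  -- period of `q`: the inverse of `q ^ i` is `q ^ (i * m)`.
  ⟨q⟩⇒q^ : ∀ {k} → k ∈ ⟨ q mod n ⟩ → ∃[ i ] toℕ k ≋ q ^ i
  ⟨q⟩⇒q^ gen = 1 , ≋-trans (toℕ-mod q) (≋-reflexive (sym (*-identityʳ q)))
  ⟨q⟩⇒q^ one = 0 , toℕ-mod 1
  ⟨q⟩⇒q^ (mul {h} {k} h∈ k∈) with ⟨q⟩⇒q^ h∈ | ⟨q⟩⇒q^ k∈
  ... | i , h≋ | j , k≋ = i + j , (begin
    toℕ (h ⊗ k)      ≈⟨ toℕ-⊗ h k ⟩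
    toℕ h * toℕ k    ≈⟨ *-≋ h≋ k≋ ⟩
    q ^ i * q ^ j    ≡⟨ ^-distribˡ-+-* q i j ⟨
    q ^ (i + j)      ∎)
  ⟨q⟩⇒q^ (inv {h} {k} h∈ hk≡1) with ⟨q⟩⇒q^ h∈
  ... | i , h≋ = i * m , (begin
    toℕ k                      ≡⟨ *-identityˡ (toℕ k) ⟨
    1 * toℕ k                  ≈⟨ *-≋ (q^-inverse i) ≋-refl ⟨
    q ^ i * Q * toℕ k          ≡⟨ rotate (q ^ i) Q (toℕ k) ⟩
    Q * (q ^ i * toℕ k)        ≈⟨ *-≋ (≋-refl {Q}) (*-≋ h≋ ≋-refl) ⟨
    Q * (toℕ h * toℕ k)        ≈⟨ *-≋ (≋-refl {Q}) (toℕ-⊗ h k) ⟨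
    Q * toℕ (h ⊗ k)            ≈⟨ *-≋ (≋-refl {Q}) (≋-trans (≋-reflexive (cong toℕ hk≡1)) (toℕ-mod 1)) ⟩
    Q * 1                      ≡⟨ *-identityʳ Q ⟩
    Q                          ∎)
    where
    Q = q ^ (i * m)
    rotate : ∀ a b c → a * b * c ≡ b * (a * c)
    rotate = solve-∀

  ⟨q⟩-inverse : ∀ {k} → k ∈ ⟨ q mod n ⟩ → ∃[ j ] j ∈ ⟨ q mod n ⟩ × j ⊗ k ≡ 1 mod n
  ⟨q⟩-inverse {k} k∈ with ⟨q⟩⇒q^ k∈
  ... | i , k≋ = j , inv k∈ kj≡1 , trans (⊗-comm j k) kj≡1
    where
    j = q ^ (i * m) mod n
    kj≡1 : k ⊗ j ≡ 1 mod n
    kj≡1 = toℕ-≋-injective (begin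
      toℕ (k ⊗ j)           ≈⟨ toℕ-⊗ k j ⟩
      toℕ k * toℕ j         ≈⟨ *-≋ k≋ (toℕ-mod (q ^ (i * m))) ⟩
      q ^ i * q ^ (i * m)   ≈⟨ q^-inverse i ⟩
      1                     ≈⟨ toℕ-mod 1 ⟨
      toℕ (1 mod n)         ∎)

  -- Two powers of `q` whose sum is twice a power.

  q^a+q^c≋2-bounded : ∀ {a c} → a ≤ m → c ≤ m → q ^ a + q ^ c ≋ 2 → q ^ a ≡ 1
  q^a+q^c≋2-bounded {a} {c} a≤m c≤m e =
    trans (sym suc-x) (cong suc (m+n≡0⇒m≡0 x x+y≡0))
    where
    -- Lowering each power by 1 moves the sum from [2 , n + 1] to [0 , n), where being congruent to
    -- 0 means being 0; both summands then vanish.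
    x = pred (q ^ a)
    y = pred (q ^ c)

    suc-x : suc x ≡ q ^ a
    suc-x = suc-pred (q ^ a) {{m^n≢0 q a}}

    suc-y : suc y ≡ q ^ c
    suc-y = suc-pred (q ^ c) {{m^n≢0 q c}}

    shift : x + y + 2 ≡ q ^ a + q ^ c
    shift = trans (move x y) (cong₂ _+_ suc-x suc-y)
      where
      move : ∀ u v → u + v + 2 ≡ suc u + suc v
      move = solve-∀

    q^a+q^c≤1+n : q ^ a + q ^ c ≤ suc n
    q^a+q^c≤1+n = ≤R.begin
      q ^ a + q ^ c   ≤R.≤⟨ +-mono-≤ (^-monoʳ-≤ q a≤m) (^-monoʳ-≤ q c≤m) ⟩
      q ^ m + q ^ m   ≤R.≡⟨ cong (q ^ m +_) (+-identityʳ (q ^ m)) ⟨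
      -- `1<q` unfolds to 2 ≤ q, which is just enough; for q = 2 the bound is attained at a = c = m.
      2 * q ^ m       ≤R.≤⟨ *-monoˡ-≤ (q ^ m) 1<q ⟩
      q ^ suc m       ≤R.≡⟨ suc-n ⟨
      suc n           ≤R.∎
      where module ≤R = ≤-Reasoning

    x+y<n : x + y < n
    x+y<n = s≤s⁻¹ (subst (_≤ suc n) (trans (sym shift) (+-comm (x + y) 2)) q^a+q^c≤1+n)

    x+y≡0 : x + y ≡ 0
    x+y≡0 = ≋-small⇒≡ x+y<n (>-nonZero⁻¹ n) (≋-cancelʳ-+ 2 (≋-trans (≋-reflexive shift) e))

  q^a+q^c≋2 : ∀ a c → q ^ a + q ^ c ≋ 2 → q ^ a ≋ 1
  q^a+q^c≋2 a c e = ≋-trans (q^-reduce a) (≋-reflexive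
    (q^a+q^c≋2-bounded (s≤s⁻¹ (m%n<n a (suc m))) (s≤s⁻¹ (m%n<n c (suc m)))
      (≋-trans (+-≋ (≋-sym (q^-reduce a)) (≋-sym (q^-reduce c))) e)))

  -- Multiplying by `q ^ (b * m)`, the inverse of `q ^ b`, reduces to right-hand side 2 with
  -- exponents `a + b * m` and `c + b * m`.
  q^a+q^c≋2q^b : ∀ a b c → q ^ a + q ^ c ≋ 2 * q ^ b → q ^ a ≋ q ^ b
  q^a+q^c≋2q^b a b c e = begin
    q ^ a                 ≡⟨ *-identityʳ (q ^ a) ⟨
    q ^ a * 1             ≈⟨ *-≋ (≋-refl {q ^ a}) (q^-inverse b) ⟨
    q ^ a * (q ^ b * Q)   ≡⟨ rotate (q ^ a) (q ^ b) Q ⟩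
    q ^ b * (q ^ a * Q)   ≡⟨ cong (q ^ b *_) (^-distribˡ-+-* q a (b * m)) ⟨
    q ^ b * q ^ (a + b * m) ≈⟨ *-≋ (≋-refl {q ^ b}) (q^a+q^c≋2 (a + b * m) (c + b * m) normalised) ⟩
    q ^ b * 1             ≡⟨ *-identityʳ (q ^ b) ⟩
    q ^ b                 ∎
    where
    Q = q ^ (b * m)

    rotate : ∀ u v w → u * (v * w) ≡ v * (u * w)
    rotate = solve-∀

    normalised : q ^ (a + b * m) + q ^ (c + b * m) ≋ 2
    normalised = begin
      q ^ (a + b * m) + q ^ (c + b * m)   ≡⟨ cong₂ _+_ (^-distribˡ-+-* q a (b * m)) (^-distribˡ-+-* q c (b * m)) ⟩
      q ^ a * Q + q ^ c * Q               ≡⟨ *-distribʳ-+ Q (q ^ a) (q ^ c) ⟨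
      (q ^ a + q ^ c) * Q                 ≈⟨ *-≋ e ≋-refl ⟩
      2 * q ^ b * Q                       ≡⟨ *-assoc 2 (q ^ b) Q ⟩
      2 * (q ^ b * Q)                     ≈⟨ *-≋ (≋-refl {2}) (q^-inverse b) ⟩
      2                                   ∎

  -- Sequences whose one-step increments are powers of `q` and whose two-step increments are doubled
  -- powers.

  q^-increments⇒linear : ∀ (s a b : ℕ → ℕ) →
    (∀ t → s (1 + t) ≋ q ^ a t + s t) → (∀ t → s (2 + t) ≋ 2 * q ^ b t + s t) →
    ∀ t → s t ≋ s 0 + t * q ^ a 0
  q^-increments⇒linear s a b s-suc s-suc² = s-linear
    where
    sum≋double : ∀ t → q ^ a t + q ^ a (suc t) ≋ 2 * q ^ b t
    -- The step from `t` to `2 + t` is evaluated twice: as two single steps and as one double step.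
    sum≋double t = ≋-cancelʳ-+ (s t) (begin
      q ^ a t + q ^ a (suc t) + s t     ≡⟨ swap (q ^ a t) (q ^ a (suc t)) (s t) ⟩
      q ^ a (suc t) + (q ^ a t + s t)   ≈⟨ +-≋ (≋-refl {q ^ a (suc t)}) (s-suc t) ⟨
      q ^ a (suc t) + s (suc t)         ≈⟨ s-suc (suc t) ⟨
      s (2 + t)                         ≈⟨ s-suc² t ⟩
      2 * q ^ b t + s t                 ∎)
      where
      swap : ∀ u v w → u + v + w ≡ v + (u + w)
      swap = solve-∀

    q^a-suc : ∀ t → q ^ a (suc t) ≋ q ^ a t
    q^a-suc t = ≋-trans
      -- The lemma identifies only the first summand with `q ^ b t`, so it is applied to the sum in
      -- both orders.
      (q^a+q^c≋2q^b (a (suc t)) (b t) (a t)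
        (≋-trans (≋-reflexive (+-comm (q ^ a (suc t)) _)) (sum≋double t)))
      (≋-sym (q^a+q^c≋2q^b (a t) (b t) (a (suc t)) (sum≋double t)))

    q^a-constant : ∀ t → q ^ a t ≋ q ^ a 0
    q^a-constant zero    = ≋-refl
    q^a-constant (suc t) = ≋-trans (q^a-suc t) (q^a-constant t)

    s-linear : ∀ t → s t ≋ s 0 + t * q ^ a 0
    s-linear zero    = ≋-reflexive (sym (+-identityʳ (s 0)))
    s-linear (suc t) = begin
      s (suc t)                        ≈⟨ s-suc t ⟩
      q ^ a t + s t                    ≈⟨ +-≋ (q^a-constant t) (s-linear t) ⟩
      q ^ a 0 + (s 0 + t * q ^ a 0)    ≡⟨ swap (q ^ a 0) (s 0) (t * q ^ a 0) ⟩
      s 0 + suc t * q ^ a 0            ∎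
      where
      swap : ∀ u v w → u + (v + w) ≡ v + (u + w)
      swap = solve-∀

  -- The two inclusions between `Aff` and `Aut`.

  Aff⊆Aut : Aff q n ⊆ Aut q n
  Aff⊆Aut {σ} (k , b , k∈ , σ-affine) x y = to , from
    where
    σ-⊖ : (σ ⟨$⟩ʳ y) ⊖ (σ ⟨$⟩ʳ x) ≡ k ⊗ (y ⊖ x)
    σ-⊖ = trans (cong₂ _⊖_ (σ-affine y) (σ-affine x)) (affine-⊖ k b x y)

    to : colour q n (σ ⟨$⟩ʳ x) (σ ⟨$⟩ʳ y) ⊆ colour q n x y
    to (h , h∈ , z≡) = h ⊗ k , mul h∈ k∈ ,
      trans z≡ (trans (cong (h ⊗_) σ-⊖) (sym (⊗-assoc h k _)))

    from : colour q n x y ⊆ colour q n (σ ⟨$⟩ʳ x) (σ ⟨$⟩ʳ y)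
    -- Here the factor `k` must be undone, and its inverse has to lie in the subgroup for the orbit
    -- to stay the same.
    from (h , h∈ , z≡) with ⟨q⟩-inverse k∈
    ... | j , j∈ , jk≡1 = h ⊗ j , mul h∈ j∈ , trans z≡ (trans (cong (h ⊗_) y⊖x≡) (sym (⊗-assoc h j _)))
      where
      y⊖x≡ : y ⊖ x ≡ j ⊗ ((σ ⟨$⟩ʳ y) ⊖ (σ ⟨$⟩ʳ x))
      y⊖x≡ = trans (sym (⊗-identityˡ (y ⊖ x)))
        (trans (cong (_⊗ (y ⊖ x)) (sym jk≡1))
        (trans (⊗-assoc j k (y ⊖ x)) (cong (j ⊗_) (sym σ-⊖))))

  -- The difference of the two images lies in the orbit of `d`, since σ preserves the colour of the
  -- pair. Only d = 1 and d = 2 are used below.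
  Aut-increment : ∀ {σ} → σ ∈ Aut q n → ∀ d t →
    ∃[ k ] k ∈ ⟨ q mod n ⟩ ×
      toℕ (σ ⟨$⟩ʳ ((d + t) mod n)) ≋ d * toℕ k + toℕ (σ ⟨$⟩ʳ (t mod n))
  Aut-increment {σ} σ-aut d t = k , k∈ , (begin
      toℕ σy                     ≈⟨ toℕ-⊖ σy σx ⟨
      toℕ (σy ⊖ σx) + toℕ σx     ≡⟨ cong (λ z → toℕ z + toℕ σx) Δ≡ ⟩
      toℕ (k ⊗ (y ⊖ x)) + toℕ σx ≈⟨ +-≋ (toℕ-⊗ k (y ⊖ x)) ≋-refl ⟩
      toℕ k * toℕ (y ⊖ x) + toℕ σx ≈⟨ +-≋ (*-≋ (≋-refl {toℕ k}) y⊖x≋d) ≋-refl ⟩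
      toℕ k * d + toℕ σx         ≡⟨ cong (_+ toℕ σx) (*-comm (toℕ k) d) ⟩
      d * toℕ k + toℕ σx         ∎)
    where
    x y σx σy : ℤ/ n
    x = t mod n
    y = (d + t) mod n
    σx = σ ⟨$⟩ʳ x
    σy = σ ⟨$⟩ʳ y

    σy⊖σx∈ : σy ⊖ σx ∈ colour q n x y
    -- Every element lies in its own orbit, with multiplier 1.
    σy⊖σx∈ = proj₁ (σ-aut x y) (1 mod n , one , sym (⊗-identityˡ (σy ⊖ σx)))

    k = proj₁ σy⊖σx∈
    k∈ = proj₁ (proj₂ σy⊖σx∈)
    Δ≡ = proj₂ (proj₂ σy⊖σx∈)

    y⊖x≋d : toℕ (y ⊖ x) ≋ d
    y⊖x≋d = ≋-cancelʳ-+ t (begin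
      toℕ (y ⊖ x) + t        ≈⟨ +-≋ ≋-refl (toℕ-mod t) ⟨
      toℕ (y ⊖ x) + toℕ x    ≈⟨ toℕ-⊖ y x ⟩
      toℕ y                  ≈⟨ toℕ-mod (d + t) ⟩
      d + t                  ∎)

  Aut⊆Aff : Aut q n ⊆ Aff q n
  -- The slope is the multiplier of the step from 0 to 1, the translation is the image of 0.
  Aut⊆Aff {σ} σ-aut = k 0 , σ0 , k∈ 0 , λ x → toℕ-≋-injective (begin
      toℕ (σ ⟨$⟩ʳ x)             ≡⟨ cong (λ z → toℕ (σ ⟨$⟩ʳ z)) (mod-toℕ x) ⟨
      s (toℕ x)                  ≈⟨ s-linear (toℕ x) ⟩
      s 0 + toℕ x * q ^ a 0      ≡⟨ swap (s 0) (toℕ x) (q ^ a 0) ⟩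
      q ^ a 0 * toℕ x + s 0      ≈⟨ +-≋ (*-≋ (k≋ 0) (≋-refl {toℕ x})) ≋-refl ⟨
      toℕ (k 0) * toℕ x + s 0    ≈⟨ +-≋ (toℕ-⊗ (k 0) x) ≋-refl ⟨
      toℕ (k 0 ⊗ x) + s 0        ≈⟨ toℕ-⊕ (k 0 ⊗ x) σ0 ⟨
      toℕ (k 0 ⊗ x ⊕ σ0)         ∎)
    where
    s : ℕ → ℕ
    -- Unrolling σ to an `n`-periodic sequence on ℕ makes plain induction available, without
    -- wrap-around.
    s t = toℕ (σ ⟨$⟩ʳ (t mod n))

    σ0 : ℤ/ n
    σ0 = σ ⟨$⟩ʳ (0 mod n)

    k l : ℕ → ℤ/ n
    k t = proj₁ (Aut-increment {σ} σ-aut 1 t)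
    l t = proj₁ (Aut-increment {σ} σ-aut 2 t)

    k∈ : ∀ t → k t ∈ ⟨ q mod n ⟩
    k∈ t = proj₁ (proj₂ (Aut-increment {σ} σ-aut 1 t))

    l∈ : ∀ t → l t ∈ ⟨ q mod n ⟩
    l∈ t = proj₁ (proj₂ (Aut-increment {σ} σ-aut 2 t))

    a b : ℕ → ℕ
    a t = proj₁ (⟨q⟩⇒q^ (k∈ t))
    b t = proj₁ (⟨q⟩⇒q^ (l∈ t))

    k≋ : ∀ t → toℕ (k t) ≋ q ^ a t
    k≋ t = proj₂ (⟨q⟩⇒q^ (k∈ t))

    s-suc : ∀ t → s (1 + t) ≋ q ^ a t + s t
    s-suc t = ≋-trans (proj₂ (proj₂ (Aut-increment {σ} σ-aut 1 t)))
      (+-≋ (≋-trans (≋-reflexive (*-identityˡ (toℕ (k t)))) (k≋ t)) ≋-refl)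

    s-suc² : ∀ t → s (2 + t) ≋ 2 * q ^ b t + s t
    s-suc² t = ≋-trans (proj₂ (proj₂ (Aut-increment {σ} σ-aut 2 t)))
      (+-≋ (*-≋ (≋-refl {2}) (proj₂ (⟨q⟩⇒q^ (l∈ t)))) ≋-refl)

    s-linear : ∀ t → s t ≋ s 0 + t * q ^ a 0
    s-linear = q^-increments⇒linear s a b s-suc s-suc²

    swap : ∀ u v w → u + v * w ≡ w * v + u
    swap = solve-∀

  Aut≐Aff : Aut q n ≐ Aff q n
  Aut≐Aff = (λ {σ} → Aut⊆Aff {σ}) , (λ {σ} → Aff⊆Aut {σ})

-- Specialisation to prime powers.

primePower>1 : ∀ {q} → PrimePower q → 1 < q
primePower>1 (p , k , p-prime , 1≤k , refl) = ^-monoʳ-< p 1<p 1≤k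
  where 1<p = nonTrivial⇒n>1 p {{prime⇒nonTrivial p-prime}}

proposition5p10 : (q : ℕ) (q-pp : PrimePower q) (m : ℕ) (m≥1 : 1 ≤ m) →
    let n = q ^ m ∸ 1
        instance
          n≢0 : NonZero n
          n≢0 = q^m∸1-nonZero q-pp m≥1
    in ¬ Exceptional q n × (Aut q n ≐ Aff q n)
proposition5p10 q q-pp (suc m) m≥1 = (λ e → Exceptional.Aut≢Aff e eq) , eq
  where
  1<q = primePower>1 q-pp
  eq = Aut≐Aff q m (q ^ suc m ∸ 1) {{q^m∸1-nonZero q-pp m≥1}} 1<q
         -- As `q ^ suc m` is positive, the subtraction of 1 does not truncate, and adding 1 to the
         -- length gives back the power.
         (m+[n∸m]≡n (m^n>0 q {{>-nonZero (<-trans z<s 1<q)}} (suc m)))
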